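{- Let $V$ be a vertex set with $|V|=n\ge 2$ and let $G$ be the disjoint union of $n-1$ spanning arborescences $A_1,\dots,A_{n-1}$ on $V$. If there are at most two multi-roots, then $G$ has a rainbow spanning arborescence.
   Context: An arborescence is a connected digraph in which exactly one vertex (the root) has no incoming arc and every other vertex has exactly one incoming arc; it is spanning on $V$ if its vertex set is $V$. $G$ is the disjoint union of the arc sets $A_i$ (parallel arcs of different indices allowed). A subgraph $B$ of $G$ is rainbow if $|B\cap A_i|\le 1$ for all $i$. A vertex $v$ is a multi-root if $v$ is the root of at least two of the arborescences $A_1,\dots,A_{n-1}$. -}

module Defs where

open import Data.Nat using (ℕ; zero; suc)
open import Data.Fin using (Fin)
open import Data.Fin.Properties using () renaming (_≟_ to _≟ᶠ_)
open import Data.Product using (_×_; _,_; proj₁; proj₂; ∃; ∃-syntax; Σ-syntax)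
open import Data.Sum using (_⊎_)
open import Data.List using (List; []; _∷_; length; lookup; filter)
open import Data.List.Membership.Propositional using (_∈_)
open import Data.Maybe using (Maybe; just; nothing)
open import Relation.Binary.PropositionalEquality using (_≡_; _≢_)
open import Relation.Nullary using (¬_)
open import Relation.Unary using (Pred)

-- An arc on vertex set Fin n: (tail , head).
Arc : ℕ → Set
Arc n = Fin n × Fin n

-- A digraph on vertex set Fin n given by a list of arcs (a multiset; parallel arcs allowed).
Digraph : ℕ → Set
Digraph n = List (Arc n)

indeg : ∀ {n} → Digraph n → Fin n → ℕ
indeg {n} D v = length (filter (λ a → proj₂ a ≟ᶠ v) D)

data Linked {n} (D : Digraph n) : Fin n → Fin n → Set where
  here : ∀ {u} → Linked D u u
  fwd  : ∀ {u w v} → (u , w) ∈ D → Linked D w v → Linked D u v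
  bwd  : ∀ {u w v} → (w , u) ∈ D → Linked D w v → Linked D u v

Connected : ∀ {n} → Digraph n → Set
Connected {n} D = ∀ (u v : Fin n) → Linked D u v

IsRoot : ∀ {n} → Digraph n → Fin n → Set
IsRoot D r = indeg D r ≡ 0

SpanningArborescence : ∀ {n} → Digraph n → Set
SpanningArborescence {n} D =
  Connected D ×
  (∃[ r ] (IsRoot D r × ∀ (v : Fin n) → v ≢ r → indeg D v ≡ 1))

-- A rainbow subgraph of the disjoint union G of the arc sets A i (i : Fin k):
-- it picks at most one arc (by position) from each A i.
RainbowSelection : ∀ {n k} → (Fin k → Digraph n) → Set
RainbowSelection {k = k} A = (i : Fin k) → Maybe (Fin (length (A i)))

selectedArcs : ∀ {n k} (A : Fin k → Digraph n) → RainbowSelection A → Digraph n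
selectedArcs {k = zero} A s = []
selectedArcs {k = suc k} A s with s Fin.zero
... | nothing = selectedArcs (λ i → A (Fin.suc i)) (λ i → s (Fin.suc i))
... | just p  = lookup (A Fin.zero) p ∷ selectedArcs (λ i → A (Fin.suc i)) (λ i → s (Fin.suc i))

MultiRoot : ∀ {n k} → (Fin k → Digraph n) → Fin n → Set
MultiRoot A v = ∃[ i ] ∃[ j ] (i ≢ j × IsRoot (A i) v × IsRoot (A j) v)

AtMostTwoMultiRoots : ∀ {n k} → (Fin k → Digraph n) → Set
AtMostTwoMultiRoots A = ∀ u v w → MultiRoot A u → MultiRoot A v → MultiRoot A w →
  (u ≡ v) ⊎ (u ≡ w) ⊎ (v ≡ w)

{-# OPTIONS --safe #-}
module Submission where

-- Choose a and b such that every other vertex is the root of at most one colour.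
--
-- Some rainbow tree contains both a and b: grow disjoint rainbow in-trees X towards a
-- and Y towards b. The root of an unused colour lies outside X or outside Y, so the
-- colour has an arc entering that set. Since n - 1 colours cannot be placed while X and Y
-- stay disjoint, the two in-trees meet in a vertex r, with paths to a and to b.
--
-- A rainbow tree S that contains a and b, with root r, can be enlarged unless it spans.
-- If an unused colour has its root in S, then it has an arc leaving S. Otherwise, by
-- counting, the colours used in S are exactly those rooted in S. Take an unused colour and
-- its arc y → r. If y ∉ S, then y becomes the new root. If y ∈ S, then adding y → r and
-- dropping the arc into y re-roots the tree at y and frees a colour rooted in S.

open import Defs
open import Data.Nat using (ℕ; zero; suc; _≤_; _∸_; s≤s)
open import Data.Nat.Properties using (<-irrefl; n<1+n) renaming (_≟_ to _≟ⁿ_)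
open import Data.Fin using (Fin; zero; suc)
open import Data.Fin.Properties using (_≟_; any?; pigeonhole; suc-injective; 0≢1+n)
open import Data.Fin.Subset using (Subset; _∈_; _∉_; _⊆_; _⊂_; _⊃_; _∪_; ⁅_⁆; ∁)
open import Data.Fin.Subset.Properties using (_∈?_; x∈p∪q⁻; x∈p∪q⁺; x∈⁅x⁆; x∈⁅y⁆⇒x≡y; x∈∁p⇒x∉p; x∉∁p⇒x∈p; x∉p⇒x∈∁p; p⊆p∪q; q⊆p∪q; ∪-comm)
open import Data.Fin.Subset.Induction using (⊃-wellFounded)
open import Data.List using ([]; _∷_; length; lookup; filter)
open import Data.List.Properties using (filter-accept; filter-reject)
open import Data.List.Membership.Propositional using () renaming (_∈_ to _∈ˡ_; _∉_ to _∉ˡ_)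
open import Data.List.Membership.Propositional.Properties using (∈-filter⁺)
open import Data.List.Relation.Unary.Any using (here; there; index)
open import Data.List.Relation.Unary.Any.Properties using (lookup-index)
open import Data.Maybe as Maybe using (Maybe; just; nothing; _<∣>_)
open import Data.Product using (∃-syntax; ∃₂; _×_; _,_; proj₁; proj₂)
open import Data.Sum using (_⊎_; inj₁; inj₂; [_,_]′; swap)
open import Data.Empty using (⊥; ⊥-elim)
open import Function using (_∘_)
open import Induction.WellFounded using (Acc; acc)
open import Relation.Binary.PropositionalEquality using (_≡_; _≢_; refl; sym; trans; cong; subst; subst₂)
open import Relation.Nullary using (¬_; Dec; yes; no; ¬?; _×-dec_)
open import Relation.Nullary.Decidable using (decidable-stable)

-- Pigeonhole for m colours and m + 1 vertices.

no-injection-avoiding-two : ∀ {m} (f : Fin m → Fin (suc m)) → (∀ {i j} → f i ≡ f j → i ≡ j) →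
  ∀ {x y} → x ≢ y → (∀ i → f i ≢ x) → (∀ i → f i ≢ y) → ⊥
no-injection-avoiding-two {m} f inj {x} {y} x≢y f≢x f≢y = collide (pigeonhole (n<1+n (suc m)) g)
  where
  g : Fin (suc (suc m)) → Fin (suc m)
  -- Putting `x` and `y` in front of `f` gives m + 2 values among m + 1 vertices. Each possible
  -- coincidence contradicts one of the hypotheses.
  g zero          = x
  g (suc zero)    = y
  g (suc (suc i)) = f i

  collide : ¬ (∃₂ λ i j → i Data.Fin.< j × g i ≡ g j)
  collide (zero        , suc zero    , _   , eq) = x≢y eq
  collide (zero        , suc (suc j) , _   , eq) = f≢x j (sym eq)
  collide (suc zero    , suc zero    , s≤s () , _)
  collide (suc zero    , suc (suc j) , _   , eq) = f≢y j (sym eq)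
  collide (suc (suc i) , suc zero    , s≤s () , _)
  collide (suc (suc i) , suc (suc j) , i<j , eq) with inj eq
  ... | refl = <-irrefl refl i<j

-- Partial functions on the colours.

module _ {B : Set} where

  nothing? : (x : Maybe B) → Dec (x ≡ nothing)
  nothing? nothing  = yes refl
  nothing? (just _) = no λ ()

  nothing⊎just : (x : Maybe B) → x ≡ nothing ⊎ (∃[ e ] x ≡ just e)
  nothing⊎just nothing  = inj₁ refl
  nothing⊎just (just e) = inj₂ (e , refl)

  clash : ∀ {x : Maybe B} {e} → x ≡ nothing → x ≡ just e → ⊥
  clash refl ()

  just-unique : ∀ {x : Maybe B} {e e′} → x ≡ just e → x ≡ just e′ → e ≡ e′
  just-unique refl refl = refl

module _ {m : ℕ} {B : Set} where

  -- A colour has at most one value, so being rainbow is built into the type. Values are arcs for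
  -- trees and vertices for labels.
  Partial : Set
  Partial = Fin m → Maybe B

  infixr 6 _⊕_

  -- Abstract, so that unification can recover the implicit arguments of the lemmas.
  abstract

    single : Fin m → B → Partial
    single i e j with j ≟ i
    ... | yes _ = just e
    ... | no  _ = nothing

    drop : Fin m → Partial → Partial
    drop k σ j with j ≟ k
    ... | yes _ = nothing
    ... | no  _ = σ j

    _⊕_ : Partial → Partial → Partial
    (σ ⊕ τ) j = σ j <∣> τ j

    single-self : ∀ i e → single i e i ≡ just e
    single-self i e with i ≟ i
    ... | yes _   = refl
    ... | no  i≢i = ⊥-elim (i≢i refl)

    single⁻ : ∀ {i e j e′} → single i e j ≡ just e′ → j ≡ i × e′ ≡ e
    single⁻ {i} {j = j} eq with j ≟ i | eq
    ... | yes j≡i | refl = j≡i , refl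
    ... | no  _   | ()

    drop⁻ : ∀ {k σ j e} → drop k σ j ≡ just e → j ≢ k × σ j ≡ just e
    drop⁻ {k} {j = j} eq with j ≟ k | eq
    ... | yes _   | ()
    ... | no  j≢k | eq′ = j≢k , eq′

    drop⁺ : ∀ {k j e} σ → j ≢ k → σ j ≡ just e → drop k σ j ≡ just e
    drop⁺ {k} {j} σ j≢k eq with j ≟ k
    ... | yes j≡k = ⊥-elim (j≢k j≡k)
    ... | no  _   = eq

    drop-nothing⁻ : ∀ {k j} σ → drop k σ j ≡ nothing → j ≡ k ⊎ σ j ≡ nothing
    drop-nothing⁻ {k} {j} σ eq with j ≟ k
    ... | yes j≡k = inj₁ j≡k
    ... | no  _   = inj₂ eq

    ⊕⁻ : ∀ {j e} σ τ → (σ ⊕ τ) j ≡ just e → σ j ≡ just e ⊎ τ j ≡ just e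
    ⊕⁻ {j} σ τ eq with σ j
    ... | just _  = inj₁ eq
    ... | nothing = inj₂ eq

    ⊕⁺ˡ : ∀ {j e} σ τ → σ j ≡ just e → (σ ⊕ τ) j ≡ just e
    ⊕⁺ˡ {j} σ τ eq with σ j | eq
    ... | just _ | refl = refl

    ⊕⁺ʳ : ∀ {j e} σ τ → σ j ≡ nothing → τ j ≡ just e → (σ ⊕ τ) j ≡ just e
    ⊕⁺ʳ {j} σ τ σj eq with σ j | σj
    ... | nothing | refl = eq

-- Directed paths.

data Path {n} (E : Fin n → Fin n → Set) (r : Fin n) : Fin n → Set where
  ε    : Path E r r
  _▻_  : ∀ {u v} → Path E r u → E u v → Path E r v

path-map : ∀ {n E F} {r v : Fin n} → (∀ {x y} → E x y → F x y) → Path E r v → Path F r v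
path-map f ε       = ε
path-map f (p ▻ e) = path-map f p ▻ f e

path-++ : ∀ {n E} {r u v : Fin n} → Path E r u → Path E u v → Path E r v
path-++ p ε       = p
path-++ p (q ▻ e) = path-++ p q ▻ e

-- The last arc is outermost in a `Path`, so the search walks back from `z`; the first arc met whose
-- tail is in `S` leaves `S`.
path-exit : ∀ {n E} {r z : Fin n} (S : Subset n) → Path E r z → r ∈ S → z ∉ S →
  ∃₂ λ s t → s ∈ S × t ∉ S × E s t
path-exit S ε r∈S z∉S = ⊥-elim (z∉S r∈S)
path-exit S (_▻_ {u} p e) r∈S z∉S with u ∈? S
... | yes u∈S = u , _ , u∈S , z∉S , e
... | no  u∉S = path-exit S p r∈S u∉S

-- ρ i is the root of colour i; exit is the only property of arborescences that the argument needs.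
module RainbowTrees {m : ℕ} (_∈ᴬ_ : Arc (suc m) → Fin m → Set) (ρ : Fin m → Fin (suc m))
  (exit : ∀ i (S : Subset (suc m)) {z} → ρ i ∈ S → z ∉ S →
    ∃₂ λ s t → s ∈ S × t ∉ S × (s , t) ∈ᴬ i) where

  -- Rainbow out-trees and the operations on them.

  Vertex : Set
  Vertex = Fin (suc m)

  Selected : Partial {m} {Arc (suc m)} → Vertex → Vertex → Set
  Selected σ u v = ∃[ i ] σ i ≡ just (u , v)

  -- An out-tree with root `r` and vertex set `S`. Tails lie in `S` as well: the path to a head `v`
  -- ends with the only arc into `v`, so its tail is `r` or again a head.
  record Tree (r : Vertex) (S : Subset (suc m)) : Set where
    field
      σ      : Partial {m} {Arc (suc m)}
      valid  : ∀ {i e} → σ i ≡ just e → e ∈ᴬ i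
      unique : ∀ {i j u u′ v} → σ i ≡ just (u , v) → σ j ≡ just (u′ , v) → i ≡ j
      rootless : ∀ {i u} → σ i ≢ just (u , r)
      heads  : ∀ {i u v} → σ i ≡ just (u , v) → v ∈ S
      root∈  : r ∈ S
      path   : ∀ {v} → v ∈ S → Path (Selected σ) r v

  open Tree

  Uses : ∀ {r S} → Tree r S → Fin m → Set
  Uses T i = ∃[ e ] σ T i ≡ just e

  trivial : ∀ r → Tree r ⁅ r ⁆
  trivial r = record
    { σ = λ _ → nothing ; valid = λ () ; unique = λ () ; rootless = λ () ; heads = λ ()
    ; root∈ = x∈⁅x⁆ r
    ; path = λ v∈ → subst (Path _ r) (sym (x∈⁅y⁆⇒x≡y r v∈)) ε }

  arc : ∀ {i s t} → s ≢ t → (s , t) ∈ᴬ i → Tree s (⁅ s ⁆ ∪ ⁅ t ⁆)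
  arc {i} {s} {t} s≢t st = record
    { σ = single i (s , t)
    ; valid = valid′
    ; unique = λ p q → trans (proj₁ (single⁻ p)) (sym (proj₁ (single⁻ q)))
    ; rootless = λ p → s≢t (cong proj₂ (proj₂ (single⁻ p)))
    ; heads = λ p → x∈p∪q⁺ (inj₂ (subst (_∈ ⁅ t ⁆) (sym (cong proj₂ (proj₂ (single⁻ p)))) (x∈⁅x⁆ t)))
    ; root∈ = x∈p∪q⁺ (inj₁ (x∈⁅x⁆ s))
    ; path = λ v∈ → [ (λ v∈s → subst (Path _ s) (sym (x∈⁅y⁆⇒x≡y s v∈s)) ε)
                    , (λ v∈t → subst (Path _ s) (sym (x∈⁅y⁆⇒x≡y t v∈t)) (ε ▻ (i , single-self i _)))
                    ]′ (x∈p∪q⁻ _ _ v∈) }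
    where
    valid′ : ∀ {j e} → single i (s , t) j ≡ just e → e ∈ᴬ j
    valid′ p with single⁻ p
    ... | refl , refl = st

  -- `T′` hangs from a vertex of `T`. The only common vertex is the root of `T′`, which has no
  -- in-arc in `T′`, so no vertex receives a second in-arc.
  graft : ∀ {r S r′ S′} (T : Tree r S) (T′ : Tree r′ S′) → r′ ∈ S →
    (∀ {v} → v ∈ S → v ∈ S′ → v ≡ r′) → (∀ {i} → Uses T i → Uses T′ i → ⊥) → Tree r (S ∪ S′)
  graft {r} {S} {r′} {S′} T T′ r′∈S meet disjoint = record
    { σ = σ T ⊕ σ T′
    ; valid = λ p → [ valid T , valid T′ ]′ (⊕⁻ (σ T) (σ T′) p)
    ; unique = unique′
    ; rootless = λ p → [ rootless T , not-head (root∈ T) ]′ (⊕⁻ (σ T) (σ T′) p)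
    ; heads = λ p → x∈p∪q⁺ ([ inj₁ ∘ heads T , inj₂ ∘ heads T′ ]′ (⊕⁻ (σ T) (σ T′) p))
    ; root∈ = x∈p∪q⁺ (inj₁ (root∈ T))
    ; path = λ v∈ → [ pathˡ , (λ v∈S′ → path-++ (pathˡ r′∈S) (path-map inʳ (path T′ v∈S′))) ]′ (x∈p∪q⁻ _ _ v∈) }
    where
    not-head : ∀ {i u v} → v ∈ S → σ T′ i ≢ just (u , v)
    not-head v∈S p with meet v∈S (heads T′ p)
    ... | refl = rootless T′ p

    unique′ : ∀ {i j u u′ v} → (σ T ⊕ σ T′) i ≡ just (u , v) → (σ T ⊕ σ T′) j ≡ just (u′ , v) → i ≡ j
    unique′ p q with ⊕⁻ (σ T) (σ T′) p | ⊕⁻ (σ T) (σ T′) q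
    ... | inj₁ p′ | inj₁ q′ = unique T p′ q′
    ... | inj₁ p′ | inj₂ q′ = ⊥-elim (not-head (heads T p′) q′)
    ... | inj₂ p′ | inj₁ q′ = ⊥-elim (not-head (heads T q′) p′)
    ... | inj₂ p′ | inj₂ q′ = unique T′ p′ q′

    inʳ : ∀ {u v} → Selected (σ T′) u v → Selected (σ T ⊕ σ T′) u v
    -- `_⊕_` prefers its left argument, so an arc of `T′` survives because `T` does not use its
    -- colour.
    inʳ (i , p) with nothing⊎just (σ T i)
    ... | inj₁ none = i , ⊕⁺ʳ (σ T) (σ T′) none p
    ... | inj₂ used = ⊥-elim (disjoint used (_ , p))

    pathˡ : ∀ {v} → v ∈ S → Path (Selected (σ T ⊕ σ T′)) r v
    pathˡ v∈S = path-map (λ (i , p) → i , ⊕⁺ˡ (σ T) (σ T′) p) (path T v∈S)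

  module _ {r S} (T : Tree r S) {c s t} (unused : σ T c ≡ nothing) (st : (s , t) ∈ᴬ c) where

    extend-below : s ∈ S → t ∉ S → Tree r (S ∪ (⁅ s ⁆ ∪ ⁅ t ⁆))
    extend-below s∈S t∉S = graft T (arc s≢t st) s∈S
      (λ v∈S v∈st → [ x∈⁅y⁆⇒x≡y s , (λ v∈t → ⊥-elim (t∉S (subst (_∈ S) (x∈⁅y⁆⇒x≡y t v∈t) v∈S))) ]′ (x∈p∪q⁻ _ _ v∈st))
      (λ (_ , p) (_ , q) → clash unused (subst (λ i → σ T i ≡ _) (proj₁ (single⁻ q)) p))
      where
      s≢t : s ≢ t
      s≢t refl = t∉S s∈S

    -- Here the single arc is the upper tree and `T` hangs from its head, which makes `s` the new
    -- root.
    extend-above : s ∉ S → t ≡ r → Tree s ((⁅ s ⁆ ∪ ⁅ t ⁆) ∪ S)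
    extend-above s∉S refl = graft (arc s≢t st) T (x∈p∪q⁺ (inj₂ (x∈⁅x⁆ t)))
      (λ v∈st v∈S → [ (λ v∈s → ⊥-elim (s∉S (subst (_∈ S) (x∈⁅y⁆⇒x≡y s v∈s) v∈S))) , x∈⁅y⁆⇒x≡y t ]′ (x∈p∪q⁻ _ _ v∈st))
      (λ (_ , q) (_ , p) → clash unused (subst (λ i → σ T i ≡ _) (proj₁ (single⁻ q)) p))
      where
      s≢t : s ≢ t
      s≢t refl = s∉S (root∈ T)

    extend-above-uses : ∀ {s∉S t≡r i} → Uses (extend-above s∉S t≡r) i → i ≡ c ⊎ Uses T i
    extend-above-uses {t≡r = refl} (e , p) =
      [ inj₁ ∘ proj₁ ∘ single⁻ , (λ q → inj₂ (e , q)) ]′ (⊕⁻ (single c (s , t)) (σ T) p)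

  in-arc : ∀ {r S v} (T : Tree r S) → v ∈ S → v ≢ r → ∃₂ λ i u → σ T i ≡ just (u , v)
  in-arc T v∈S v≢r with path T v∈S
  ... | ε           = ⊥-elim (v≢r refl)
  ... | _ ▻ (i , p) = i , _ , p

  -- The arc from `y` to `r` closes a cycle with the tree path from `r` to `y`. Deleting the arc
  -- into `y` opens this cycle at `y`, keeps the vertex set and frees the colour `k`.
  rotate : ∀ {r S c k x y} (T : Tree r S) → σ T c ≡ nothing → (y , r) ∈ᴬ c → y ≢ r →
    σ T k ≡ just (x , y) → ∃[ T′ ] σ {y} {S} T′ k ≡ nothing
  rotate {r} {S} {c} {k} {x} {y} T c-unused yr y≢r k-arc = record
    { σ = σ′
    ; valid = λ p → [ valid T ∘ proj₂ ∘ drop⁻ , valid₂ ]′ (⊕⁻ σ₁ σ₂ p)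
    ; unique = unique′
    ; rootless = λ p → [ rootless₁ , (λ q → y≢r (cong proj₂ (proj₂ (single⁻ q)))) ]′ (⊕⁻ σ₁ σ₂ p)
    ; heads = λ p → [ heads T ∘ proj₂ ∘ drop⁻
                    , (λ q → subst (_∈ S) (sym (cong proj₂ (proj₂ (single⁻ q)))) (root∈ T)) ]′ (⊕⁻ σ₁ σ₂ p)
    ; root∈ = heads T k-arc
    ; path = λ v∈S → reroot (path T v∈S) } , k-unused
    where
    σ₁ σ₂ σ′ : Partial
    σ₁ = drop k (σ T)
    σ₂ = single c (y , r)
    σ′ = σ₁ ⊕ σ₂

    valid₂ : ∀ {i e} → σ₂ i ≡ just e → e ∈ᴬ i
    valid₂ p with single⁻ p
    ... | refl , refl = yr

    not-root : ∀ {i j u u′ v} → σ₁ i ≡ just (u , v) → σ₂ j ≢ just (u′ , v)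
    not-root p q with single⁻ q
    ... | _ , refl = rootless T (proj₂ (drop⁻ p))

    rootless₁ : ∀ {i u} → σ₁ i ≢ just (u , y)
    rootless₁ p = proj₁ (drop⁻ p) (unique T (proj₂ (drop⁻ p)) k-arc)

    unique′ : ∀ {i j u u′ v} → σ′ i ≡ just (u , v) → σ′ j ≡ just (u′ , v) → i ≡ j
    unique′ p q with ⊕⁻ σ₁ σ₂ p | ⊕⁻ σ₁ σ₂ q
    ... | inj₁ p′ | inj₁ q′ = unique T (proj₂ (drop⁻ p′)) (proj₂ (drop⁻ q′))
    ... | inj₁ p′ | inj₂ q′ = ⊥-elim (not-root p′ q′)
    ... | inj₂ p′ | inj₁ q′ = ⊥-elim (not-root q′ p′)
    ... | inj₂ p′ | inj₂ q′ = trans (proj₁ (single⁻ p′)) (sym (proj₁ (single⁻ q′)))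

    c-free : σ₁ c ≡ nothing
    c-free with nothing⊎just (σ₁ c)
    ... | inj₁ none    = none
    ... | inj₂ (_ , p) = ⊥-elim (clash c-unused (proj₂ (drop⁻ p)))

    k-unused : σ′ k ≡ nothing
    k-unused with nothing⊎just (σ′ k)
    ... | inj₁ none = none
    ... | inj₂ (_ , p) with ⊕⁻ σ₁ σ₂ p
    ...   | inj₁ q = ⊥-elim (proj₁ (drop⁻ q) refl)
    ...   | inj₂ q = ⊥-elim (clash c-unused (subst (λ i → σ T i ≡ _) (proj₁ (single⁻ q)) k-arc))

    reroot : ∀ {v} → Path (Selected (σ T)) r v → Path (Selected σ′) y v
    -- A path that avoids the deleted arc is prefixed with the arc from `y` to `r`; a path through
    -- it is cut so that it starts at `y`.
    reroot ε = ε ▻ (c , ⊕⁺ʳ σ₁ σ₂ c-free (single-self c _))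
    reroot (p ▻ (i , q)) with i ≟ k
    ... | no i≢k = reroot p ▻ (i , ⊕⁺ˡ σ₁ σ₂ (drop⁺ (σ T) i≢k q))
    ... | yes refl with just-unique q k-arc
    ...   | refl = ε

  -- Enlarging a rainbow tree that contains a and b.

  TreeOn : Subset (suc m) → Set
  TreeOn S = ∃[ r ] Tree r S

  module _ (a b : Vertex) where

    Joining : Set
    Joining = ∃[ S ] (a ∈ S × b ∈ S × TreeOn S)

    module _ (ρ-injective : ∀ {i j v} → v ≢ a → v ≢ b → ρ i ≡ v → ρ j ≡ v → i ≡ j) where

      -- Sending a colour with an arc in τ to the head of that arc, and any other colour to its root,
      -- would be an injection that misses both x and y.
      overcharged : ∀ {S} → a ∈ S → b ∈ S → (τ : Partial {m} {Arc (suc m)}) →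
        (∀ {i j u u′ v} → τ i ≡ just (u , v) → τ j ≡ just (u′ , v) → i ≡ j) →
        (∀ {i u v} → τ i ≡ just (u , v) → v ∈ S) →
        (∀ {i} → τ i ≡ nothing → ρ i ∉ S) →
        ∀ {x y} → x ≢ y → x ∈ S → (∀ {i u} → τ i ≢ just (u , x)) → (∀ {i u} → τ i ≢ just (u , y)) →
        ¬ (∀ i → τ i ≡ nothing → ρ i ≢ y)
      overcharged {S} a∈S b∈S τ uniq head out {x} {y} x≢y x∈S τ≢x τ≢y ρ≢y =
        no-injection-avoiding-two (proj₁ ∘ charge) inj x≢y ≢x ≢y
        where
        charge : ∀ i → ∃[ v ] ((∃[ u ] τ i ≡ just (u , v)) ⊎ (τ i ≡ nothing × ρ i ≡ v))
        charge i with nothing⊎just (τ i)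
        ... | inj₁ none          = ρ i , inj₂ (none , refl)
        ... | inj₂ ((u , v) , p) = v , inj₁ (u , p)

        inj : ∀ {i j} → proj₁ (charge i) ≡ proj₁ (charge j) → i ≡ j
        inj {i} {j} eq with charge i | charge j
        inj refl | v , inj₁ (_ , p) | _ , inj₁ (_ , q) = uniq p q
        -- Heads lie in `S`, whereas a colour without an arc has its root outside `S`, so a head and
        -- such a root never coincide.
        inj refl | v , inj₁ (_ , p) | _ , inj₂ (q , refl) = ⊥-elim (out q (head p))
        inj refl | v , inj₂ (p , refl) | _ , inj₁ (_ , q) = ⊥-elim (out p (head q))
        inj refl | v , inj₂ (p , refl) | _ , inj₂ (q , eq) =
          -- The common root lies outside `S`, hence is neither `a` nor `b`.
          ρ-injective (λ v≡a → out p (subst (_∈ S) (sym v≡a) a∈S)) (λ v≡b → out p (subst (_∈ S) (sym v≡b) b∈S)) refl eq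

        ≢x : ∀ i → proj₁ (charge i) ≢ x
        ≢x i eq with charge i
        ≢x i refl | _ , inj₁ (_ , p)    = τ≢x p
        ≢x i refl | _ , inj₂ (p , refl) = out p x∈S

        ≢y : ∀ i → proj₁ (charge i) ≢ y
        ≢y i eq with charge i
        ≢y i refl | _ , inj₁ (_ , p)    = τ≢y p
        ≢y i refl | _ , inj₂ (p , refl) = ρ≢y i p refl

      module _ {S z} (a∈S : a ∈ S) (b∈S : b ∈ S) (z∉S : z ∉ S) where

        Enlarged : Set
        Enlarged = ∃[ S′ ] (S ⊂ S′ × TreeOn S′)

        -- The path of colour `c` from its root in `S` to `z` has to leave `S`, and the leaving arc
        -- can be hung below `T`.
        use-inner-root : ∀ {r c} (T : Tree r S) → σ T c ≡ nothing → ρ c ∈ S → Enlarged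
        use-inner-root {c = c} T unused ρc∈S with exit c S ρc∈S z∉S
        ... | s , t , s∈S , t∉S , st =
          _ , (p⊆p∪q _ , t , x∈p∪q⁺ (inj₂ (x∈p∪q⁺ (inj₂ (x∈⁅x⁆ t)))) , t∉S) , _ , extend-below T unused st s∈S t∉S

        use-arc-into-root : ∀ {r c y} (T : Tree r S) → (∀ {i} → σ T i ≡ nothing → ρ i ∉ S) →
          σ T c ≡ nothing → (y , r) ∈ᴬ c → y ≢ r → Enlarged
        use-arc-into-root {r} {c} {y} T out unused yr y≢r with y ∈? S
        ... | no y∉S =
          _ , (q⊆p∪q _ _ , y , x∈p∪q⁺ (inj₁ (x∈p∪q⁺ (inj₁ (x∈⁅x⁆ y)))) , y∉S) , _ , extend-above T unused yr y∉S refl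
        ... | yes y∈S with in-arc T y∈S y≢r
        ...   | k , x , k-arc with ρ k ∈? S
        ...     | yes ρk∈S = let T′ , k-unused = rotate T unused yr y≢r k-arc in use-inner-root T′ k-unused ρk∈S
        -- Without the colour `k`, neither `r` nor `y` has an in-arc. Both are in `S`, so neither is
        -- the root of a colour without an arc, and the count misses two vertices.
        ...     | no ρk∉S = ⊥-elim (overcharged a∈S b∈S (drop k (σ T))
                    (λ p q → unique T (proj₂ (drop⁻ p)) (proj₂ (drop⁻ q)))
                    (λ p → heads T (proj₂ (drop⁻ p)))
                    out′ (y≢r ∘ sym) (root∈ T)
                    (λ p → rootless T (proj₂ (drop⁻ p)))
                    (λ p → proj₁ (drop⁻ p) (unique T (proj₂ (drop⁻ p)) k-arc))
                    (λ i p ρi≡y → out′ p (subst (_∈ S) (sym ρi≡y) y∈S)))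
          where
          out′ : ∀ {i} → drop k (σ T) i ≡ nothing → ρ i ∉ S
          out′ {i} p with drop-nothing⁻ {k = k} {i} (σ T) p
          ... | inj₁ refl = ρk∉S
          ... | inj₂ q    = out q

        enlarge : TreeOn S → Enlarged
        enlarge (r , T) with any? (λ i → nothing? (σ T i) ×-dec (ρ i ∈? S))
        ... | yes (c , unused , ρc∈S) = use-inner-root T unused ρc∈S
        ... | no none with any? (λ i → nothing? (σ T i))
        -- If every colour is used, the heads of the m arcs are distinct and miss both `r` and `z`.
        ...   | no all-used = ⊥-elim (overcharged a∈S b∈S (σ T) (unique T) (heads T)
                  (λ p → ⊥-elim (all-used (_ , p))) (λ r≡z → z∉S (subst (_∈ S) r≡z (root∈ T))) (root∈ T)
                  (rootless T) (λ p → z∉S (heads T p)) (λ i p → ⊥-elim (all-used (i , p))))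
        -- Leaving the complement of `r` means entering `r`. The root of `c` is outside `S`, hence
        -- differs from `r`, so colour `c` has such an arc.
        ...   | yes (c , unused) with exit c (∁ ⁅ r ⁆) {r}
                  (x∉p⇒x∈∁p λ ρc∈r → none (c , unused , subst (_∈ S) (sym (x∈⁅y⁆⇒x≡y r ρc∈r)) (root∈ T)))
                  (λ r∈∁ → x∈∁p⇒x∉p r∈∁ (x∈⁅x⁆ r))
        ...     | y , t , y∈∁ , t∉∁ , yt with x∈⁅y⁆⇒x≡y r (x∉∁p⇒x∈p t∉∁)
        ...       | refl = use-arc-into-root T (λ p ρ∈S → none (_ , p , ρ∈S)) unused yt
                      (λ { refl → x∈∁p⇒x∉p y∈∁ (x∈⁅x⁆ y) })

      span : ∀ {S} → Acc _⊃_ S → a ∈ S → b ∈ S → TreeOn S → ∃[ S′ ] ((∀ v → v ∈ S′) × TreeOn S′)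
      span {S} (acc rs) a∈S b∈S T with any? (λ z → ¬? (z ∈? S))
      ... | no none = S , (λ v → decidable-stable (v ∈? S) (λ v∉S → none (v , v∉S))) , T
      ... | yes (z , z∉S) with enlarge a∈S b∈S z∉S T
      ...   | S′ , S⊂S′ , T′ = span (rs S⊂S′) (proj₁ S⊂S′ a∈S) (proj₁ S⊂S′ b∈S) T′

  -- Growing disjoint in-trees towards a and b until they meet.

  Labels : Set
  Labels = Partial {m} {Vertex}

  -- A rainbow tree from x through a that lies in X and only uses colours with labels in X.
  Leads : Vertex → Subset (suc m) → Labels → Vertex → Set
  Leads a X ℓ x = ∃[ S ] ∃[ T ] (a ∈ S × S ⊆ X × (∀ {i} → Uses {x} {S} T i → ∃[ v ] (ℓ i ≡ just v × v ∈ X)))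

  -- A colour is labelled with the vertex at whose addition to X or Y it was used.
  record Web (a b : Vertex) (X Y : Subset (suc m)) (ℓ : Labels) : Set where
    field
      disjoint : ∀ {v} → v ∈ X → v ∉ Y
      a∈X      : a ∈ X
      b∈Y      : b ∈ Y
      ℓ-unique : ∀ {i j v} → ℓ i ≡ just v → ℓ j ≡ just v → i ≡ j
      ℓ≢a      : ∀ {i} → ℓ i ≢ just a
      ℓ≢b      : ∀ {i} → ℓ i ≢ just b
      ℓ∈       : ∀ {i v} → ℓ i ≡ just v → v ∈ X ⊎ v ∈ Y
      leadsX   : ∀ {x} → x ∈ X → Leads a X ℓ x
      leadsY   : ∀ {y} → y ∈ Y → Leads b Y ℓ y

  open Web

  -- By this symmetry `step` only has to treat growth on the side of `X`.
  flip-web : ∀ {a b X Y ℓ} → Web a b X Y ℓ → Web b a Y X ℓ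
  flip-web W = record
    { disjoint = λ v∈Y v∈X → disjoint W v∈X v∈Y ; a∈X = b∈Y W ; b∈Y = a∈X W
    ; ℓ-unique = ℓ-unique W ; ℓ≢a = ℓ≢b W ; ℓ≢b = ℓ≢a W ; ℓ∈ = swap ∘ ℓ∈ W
    ; leadsX = leadsY W ; leadsY = leadsX W }

  initial-web : ∀ {a b} → a ≢ b → Web a b ⁅ a ⁆ ⁅ b ⁆ (λ _ → nothing)
  initial-web {a} {b} a≢b = record
    { disjoint = λ v∈a v∈b → a≢b (trans (sym (x∈⁅y⁆⇒x≡y a v∈a)) (x∈⁅y⁆⇒x≡y b v∈b))
    ; a∈X = x∈⁅x⁆ a ; b∈Y = x∈⁅x⁆ b
    ; ℓ-unique = λ () ; ℓ≢a = λ () ; ℓ≢b = λ () ; ℓ∈ = λ ()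
    ; leadsX = leads a ; leadsY = leads b }
    where
    leads : ∀ c {x} → x ∈ ⁅ c ⁆ → Leads c ⁅ c ⁆ (λ _ → nothing) x
    leads c x∈c with x∈⁅y⁆⇒x≡y c x∈c
    ... | refl = ⁅ c ⁆ , trivial c , x∈⁅x⁆ c , (λ v∈ → v∈) , λ ()

  -- Either side may grow in turn, so the union of both is the measure on which `connect` recurses.
  Progress : Vertex → Vertex → Subset (suc m) → Subset (suc m) → Set
  Progress a b X Y = Joining a b ⊎ ∃[ X′ ] ∃[ ℓ′ ] ((X ∪ Y) ⊂ (X′ ∪ Y) × Web a b X′ Y ℓ′)

  -- The path of colour `c` from its root outside `X` to `a` enters `X` by an arc from some `w` to
  -- some `x`. Put above the tree that leads from `x` to `a`, this arc leads from `w` to `a`. If `w`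
  -- is in `Y`, the two sides meet at `w`; otherwise `w` joins `X`.
  step : ∀ {a b X Y ℓ c} → Web a b X Y ℓ → ℓ c ≡ nothing → ρ c ∉ X → Progress a b X Y
  step {a} {b} {X} {Y} {ℓ} {c} W fresh ρc∉X with exit c (∁ X) {a} (x∉p⇒x∈∁p ρc∉X) (λ a∈∁ → x∈∁p⇒x∉p a∈∁ (a∈X W))
  ... | w , x , w∈∁ , x∉∁ , wx with leadsX W (x∉∁p⇒x∈p x∉∁)
  ...   | S , T , a∈S , S⊆X , labelled = by-case (w ∈? Y)
    where
    w∉X : w ∉ X
    w∉X = x∈∁p⇒x∉p w∈∁

    w∉S : w ∉ S
    w∉S w∈S = w∉X (S⊆X w∈S)

    unused : σ T c ≡ nothing
    unused with nothing⊎just (σ T c)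
    ... | inj₁ none = none
    ... | inj₂ used = ⊥-elim (clash fresh (proj₁ (proj₂ (labelled used))))

    S⁺ : Subset (suc m)
    S⁺ = (⁅ w ⁆ ∪ ⁅ x ⁆) ∪ S

    T⁺ : Tree w S⁺
    T⁺ = extend-above T unused wx w∉S refl

    uses⁺ : ∀ {i} → Uses T⁺ i → i ≡ c ⊎ Uses T i
    uses⁺ = extend-above-uses T unused wx {w∉S} {refl}

    split⁺ : ∀ {v} → v ∈ S⁺ → v ∈ X ⊎ v ≡ w
    split⁺ v∈ with x∈p∪q⁻ _ _ v∈
    ... | inj₂ v∈S = inj₁ (S⊆X v∈S)
    ... | inj₁ v∈wx with x∈p∪q⁻ _ _ v∈wx
    ...   | inj₁ v∈w = inj₂ (x∈⁅y⁆⇒x≡y w v∈w)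
    ...   | inj₂ v∈x = inj₁ (subst (_∈ X) (sym (x∈⁅y⁆⇒x≡y x v∈x)) (x∉∁p⇒x∈p x∉∁))

    meet-at : w ∈ Y → Joining a b
    meet-at w∈Y with leadsY W w∈Y
    ... | S₂ , T₂ , b∈S₂ , S₂⊆Y , labelled₂ =
      S⁺ ∪ S₂ , x∈p∪q⁺ (inj₁ (x∈p∪q⁺ (inj₂ a∈S))) , x∈p∪q⁺ (inj₂ b∈S₂) , w , graft T⁺ T₂ (root∈ T⁺) meet colours
      where
      meet : ∀ {v} → v ∈ S⁺ → v ∈ S₂ → v ≡ w
      meet v∈ v∈S₂ = [ (λ v∈X → ⊥-elim (disjoint W v∈X (S₂⊆Y v∈S₂))) , (λ eq → eq) ]′ (split⁺ v∈)

      colours : ∀ {i} → Uses T⁺ i → Uses T₂ i → ⊥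
      -- A colour of both trees cannot be `c`, which has no label; any other would have its label in
      -- `X` and in `Y`.
      colours u u₂ with labelled₂ u₂ | uses⁺ u
      ... | v , ℓi , v∈Y | inj₁ refl = clash fresh ℓi
      ... | v , ℓi , v∈Y | inj₂ u′ with labelled u′
      ...   | v′ , ℓi′ , v′∈X with just-unique ℓi ℓi′
      ...     | refl = disjoint W v′∈X v∈Y

    module _ (w∉Y : w ∉ Y) where

      X′ : Subset (suc m)
      X′ = X ∪ ⁅ w ⁆

      w∈X′ : w ∈ X′
      w∈X′ = x∈p∪q⁺ (inj₂ (x∈⁅x⁆ w))

      split′ : ∀ {v} → v ∈ X′ → v ∈ X ⊎ v ≡ w
      split′ v∈ = [ inj₁ , inj₂ ∘ x∈⁅y⁆⇒x≡y w ]′ (x∈p∪q⁻ _ _ v∈)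

      join′ : ∀ {v} → v ∈ X ⊎ v ≡ w → v ∈ X′
      join′ = [ p⊆p∪q _ , (λ { refl → w∈X′ }) ]′

      ℓ′ : Labels
      ℓ′ = ℓ ⊕ single c w

      ℓ′⁻ : ∀ {i v} → ℓ′ i ≡ just v → ℓ i ≡ just v ⊎ (i ≡ c × v ≡ w)
      ℓ′⁻ p = [ inj₁ , inj₂ ∘ single⁻ ]′ (⊕⁻ ℓ (single c w) p)

      -- Old labels lie in `X` or `Y`, so `w` is a new one and labels stay distinct.
      ℓ≢w : ∀ {i} → ℓ i ≢ just w
      ℓ≢w p = [ w∉X , w∉Y ]′ (ℓ∈ W p)

      ℓ′-unique : ∀ {i j v} → ℓ′ i ≡ just v → ℓ′ j ≡ just v → i ≡ j
      ℓ′-unique p q with ℓ′⁻ p | ℓ′⁻ q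
      ... | inj₁ p′         | inj₁ q′         = ℓ-unique W p′ q′
      ... | inj₁ p′         | inj₂ (_ , refl) = ⊥-elim (ℓ≢w p′)
      ... | inj₂ (_ , refl) | inj₁ q′         = ⊥-elim (ℓ≢w q′)
      ... | inj₂ (refl , _) | inj₂ (refl , _) = refl

      avoids : ∀ {v i} → v ≢ w → (∀ {j} → ℓ j ≢ just v) → ℓ′ i ≢ just v
      avoids v≢w ℓ≢v p = [ ℓ≢v , v≢w ∘ proj₂ ]′ (ℓ′⁻ p)

      leads-mono : ∀ {d Z Z′ z} → (∀ {v} → v ∈ Z → v ∈ Z′) → Leads d Z ℓ z → Leads d Z′ ℓ′ z
      leads-mono Z⊆Z′ (_ , T₀ , d∈ , S⊆ , lab) = _ , T₀ , d∈ , (λ v∈ → Z⊆Z′ (S⊆ v∈)) ,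
        λ u → let v , p , v∈ = lab u in v , ⊕⁺ˡ ℓ (single c w) p , Z⊆Z′ v∈

      leads-w : Leads a X′ ℓ′ w
      leads-w = S⁺ , T⁺ , x∈p∪q⁺ (inj₂ a∈S) , (λ v∈ → join′ (split⁺ v∈)) , λ u → label (uses⁺ u)
        where
        label : ∀ {i} → i ≡ c ⊎ Uses T i → ∃[ v ] (ℓ′ i ≡ just v × v ∈ X′)
        label (inj₁ refl) = w , ⊕⁺ʳ ℓ (single c w) fresh (single-self c w) , w∈X′
        label (inj₂ u)    = let v , p , v∈ = labelled u in v , ⊕⁺ˡ ℓ (single c w) p , join′ (inj₁ v∈)

      web′ : Web a b X′ Y ℓ′
      web′ = record
        { disjoint = λ v∈X′ v∈Y → [ (λ v∈X → disjoint W v∈X v∈Y) , (λ { refl → w∉Y v∈Y }) ]′ (split′ v∈X′)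
        ; a∈X = join′ (inj₁ (a∈X W)) ; b∈Y = b∈Y W
        ; ℓ-unique = ℓ′-unique
        ; ℓ≢a = avoids (λ { refl → w∉X (a∈X W) }) (ℓ≢a W)
        ; ℓ≢b = avoids (λ { refl → w∉Y (b∈Y W) }) (ℓ≢b W)
        ; ℓ∈ = λ p → [ (λ q → [ inj₁ ∘ join′ ∘ inj₁ , inj₂ ]′ (ℓ∈ W q)) , (λ (_ , v≡w) → inj₁ (join′ (inj₂ v≡w))) ]′ (ℓ′⁻ p)
        ; leadsX = λ v∈X′ → [ (λ v∈X → leads-mono (p⊆p∪q _) (leadsX W v∈X)) , (λ { refl → leads-w }) ]′ (split′ v∈X′)
        ; leadsY = λ v∈Y → leads-mono (λ z∈ → z∈) (leadsY W v∈Y) }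

      grown : (X ∪ Y) ⊂ (X′ ∪ Y)
      grown = (λ v∈ → x∈p∪q⁺ ([ inj₁ ∘ p⊆p∪q _ , inj₂ ]′ (x∈p∪q⁻ X Y v∈)))
            , w , x∈p∪q⁺ (inj₁ w∈X′) , λ w∈ → [ w∉X , w∉Y ]′ (x∈p∪q⁻ X Y w∈)

    by-case : Dec (w ∈ Y) → Progress a b X Y
    by-case (yes w∈Y) = inj₁ (meet-at w∈Y)
    by-case (no  w∉Y) = inj₂ (X′ w∉Y , ℓ′ w∉Y , grown w∉Y , web′ w∉Y)

  connect : ∀ {a b X Y ℓ} → a ≢ b → Acc _⊃_ (X ∪ Y) → Web a b X Y ℓ → Joining a b
  connect {a} {b} {X} {Y} {ℓ} a≢b (acc rs) W with any? (λ c → nothing? (ℓ c))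
  -- If every colour were labelled, the labels would be m distinct vertices missing both `a` and
  -- `b`.
  ... | no none = ⊥-elim (no-injection-avoiding-two (proj₁ ∘ label)
          (λ {i} {j} eq → ℓ-unique W (proj₂ (label i)) (trans (proj₂ (label j)) (cong just (sym eq))))
          a≢b (λ i eq → ℓ≢a W (trans (proj₂ (label i)) (cong just eq)))
          (λ i eq → ℓ≢b W (trans (proj₂ (label i)) (cong just eq))))
    where
    label : ∀ i → ∃[ v ] ℓ i ≡ just v
    label i with nothing⊎just (ℓ i)
    ... | inj₁ p = ⊥-elim (none (i , p))
    ... | inj₂ p = p
  ... | yes (c , fresh) with ρ c ∈? X
  ...   | no ρc∉X with step W fresh ρc∉X
  ...     | inj₁ joined = joined
  ...     | inj₂ (_ , _ , larger , W′) = connect a≢b (rs larger) W′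
  -- A root in `X` is outside the disjoint set `Y`, so the colour enters `Y` and the flipped web can
  -- grow.
  connect {a} {b} {X} {Y} {ℓ} a≢b (acc rs) W | yes (c , fresh) | yes ρc∈X
    with step (flip-web W) fresh (disjoint W ρc∈X)
  ... | inj₁ (S , b∈S , a∈S , T) = S , a∈S , b∈S , T
  ... | inj₂ (Y′ , _ , larger , W′) =
    connect a≢b (rs (subst₂ _⊂_ (∪-comm Y X) (∪-comm Y′ X) larger)) (flip-web W′)

  spanning-tree : ∀ a b → (∀ {i j v} → v ≢ a → v ≢ b → ρ i ≡ v → ρ j ≡ v → i ≡ j) →
    ∃[ S ] ((∀ v → v ∈ S) × TreeOn S)
  spanning-tree a b ρ-injective with joining
    where
    joining : Joining a b
    joining with a ≟ b
    ... | yes refl = ⁅ a ⁆ , x∈⁅x⁆ a , x∈⁅x⁆ a , a , trivial a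
    ... | no a≢b   = connect a≢b (⊃-wellFounded _) (initial-web a≢b)
  ... | S , a∈S , b∈S , T = span a b ρ-injective (⊃-wellFounded S) a∈S b∈S T

-- Between in-degrees with undirected links and directed paths.

module _ {n} (D : Digraph n) where

  root-no-arc : ∀ {u v} → IsRoot D v → (u , v) ∉ˡ D
  root-no-arc {u} {v} isRoot uv∈D with filter (λ e → proj₂ e ≟ v) D | ∈-filter⁺ (λ e → proj₂ e ≟ v) uv∈D refl
  root-no-arc () uv∈D | _ ∷ _ | here _
  root-no-arc () uv∈D | _ ∷ _ | there _

  tail-unique : ∀ {u u′ v} → indeg D v ≡ 1 → (u , v) ∈ˡ D → (u′ , v) ∈ˡ D → u ≡ u′
  tail-unique {v = v} deg p q with filter (λ e → proj₂ e ≟ v) D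
    | ∈-filter⁺ (λ e → proj₂ e ≟ v) p refl | ∈-filter⁺ (λ e → proj₂ e ≟ v) q refl
  tail-unique refl p q | _ ∷ [] | here refl | here refl = refl

  -- An undirected walk from the root is followed while keeping a directed path to the current
  -- vertex. A forward arc lengthens the path. A backward arc is the only arc into the current
  -- vertex, hence the last one of the path, and shortens it; at the root there is none.
  root-path : (arb : SpanningArborescence D) → ∀ v → Path (λ x y → (x , y) ∈ˡ D) (proj₁ (proj₂ arb)) v
  root-path (connected , r , isRoot , deg) v = follow (connected r v) ε
    where
    follow : ∀ {u} → Linked D u v → Path (λ x y → (x , y) ∈ˡ D) r u → Path (λ x y → (x , y) ∈ˡ D) r v
    follow here      p = p
    follow (fwd e l) p = follow l (p ▻ e)
    follow (bwd e l) ε = ⊥-elim (root-no-arc isRoot e)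
    follow (bwd {u} e l) (p ▻ e′) with u ≟ r
    ... | yes refl = ⊥-elim (root-no-arc isRoot e)
    ... | no u≢r with tail-unique (deg u u≢r) e e′
    ...   | refl = follow l p

  -- A link from `u` to `v` climbs against the arcs to `r` and then descends.
  paths⇒connected : ∀ {r} → (∀ v → Path (λ x y → (x , y) ∈ˡ D) r v) → Connected D
  paths⇒connected {r} paths u v = back (paths u) (forth (paths v) here)
    where
    forth : ∀ {x y} → Path (λ x y → (x , y) ∈ˡ D) r x → Linked D x y → Linked D r y
    forth ε       l = l
    forth (p ▻ e) l = forth p (fwd e l)

    back : ∀ {x y} → Path (λ x y → (x , y) ∈ˡ D) r x → Linked D r y → Linked D x y
    back ε       l = l
    back (p ▻ e) l = bwd e (back p l)

-- Turning partial functions into rainbow selections.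

chosen : ∀ {n k} (A : Fin k → Digraph n) → RainbowSelection A → Fin k → Maybe (Arc n)
chosen A s i = Maybe.map (lookup (A i)) (s i)

-- This and the next lemma make the two branches of `selectedArcs` available as rewrite rules
-- phrased with `chosen`, the form in which trees supply their arcs.
selectedArcs-nothing : ∀ {n k} (A : Fin (suc k) → Digraph n) (s : RainbowSelection A) →
  chosen A s zero ≡ nothing → selectedArcs A s ≡ selectedArcs (A ∘ suc) (s ∘ suc)
selectedArcs-nothing A s eq with s zero | eq
... | nothing | _ = refl

selectedArcs-just : ∀ {n k e} (A : Fin (suc k) → Digraph n) (s : RainbowSelection A) →
  chosen A s zero ≡ just e → selectedArcs A s ≡ e ∷ selectedArcs (A ∘ suc) (s ∘ suc)
selectedArcs-just A s eq with s zero | eq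
... | just _ | refl = refl

∈-selectedArcs : ∀ {n k e} (A : Fin k → Digraph n) (s : RainbowSelection A) i →
  chosen A s i ≡ just e → e ∈ˡ selectedArcs A s
∈-selectedArcs A s zero eq rewrite selectedArcs-just A s eq = here refl
∈-selectedArcs A s (suc i) eq with nothing⊎just (chosen A s zero)
... | inj₁ none    rewrite selectedArcs-nothing A s none = ∈-selectedArcs (A ∘ suc) (s ∘ suc) i eq
... | inj₂ (_ , p) rewrite selectedArcs-just A s p = there (∈-selectedArcs (A ∘ suc) (s ∘ suc) i eq)

indeg-≢ : ∀ {n} (e : Arc n) D {v} → proj₂ e ≢ v → indeg (e ∷ D) v ≡ indeg D v
indeg-≢ e D {v} e≢v = cong length (filter-reject (λ e → proj₂ e ≟ v) e≢v)

indeg-≡ : ∀ {n} (e : Arc n) D {v} → proj₂ e ≡ v → indeg (e ∷ D) v ≡ suc (indeg D v)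
indeg-≡ e D {v} e≡v = cong length (filter-accept (λ e → proj₂ e ≟ v) e≡v)

indeg-selectedArcs-0 : ∀ {n k v} (A : Fin k → Digraph n) (s : RainbowSelection A) →
  (∀ {i u} → chosen A s i ≢ just (u , v)) → indeg (selectedArcs A s) v ≡ 0
indeg-selectedArcs-0 {k = zero} A s avoid = refl
indeg-selectedArcs-0 {k = suc k} A s avoid with nothing⊎just (chosen A s zero)
... | inj₁ none rewrite selectedArcs-nothing A s none = indeg-selectedArcs-0 (A ∘ suc) (s ∘ suc) avoid
... | inj₂ (e , p) rewrite selectedArcs-just A s p =
  trans (indeg-≢ e (selectedArcs (A ∘ suc) (s ∘ suc)) λ { refl → avoid p }) (indeg-selectedArcs-0 (A ∘ suc) (s ∘ suc) avoid)

indeg-selectedArcs-1 : ∀ {n k u v} (A : Fin k → Digraph n) (s : RainbowSelection A) i →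
  chosen A s i ≡ just (u , v) → (∀ {j u′} → chosen A s j ≡ just (u′ , v) → j ≡ i) →
  indeg (selectedArcs A s) v ≡ 1
indeg-selectedArcs-1 A s zero eq unique rewrite selectedArcs-just A s eq =
  trans (indeg-≡ _ (selectedArcs (A ∘ suc) (s ∘ suc)) refl) (cong suc (indeg-selectedArcs-0 (A ∘ suc) (s ∘ suc) λ p → 0≢1+n (sym (unique p))))
indeg-selectedArcs-1 A s (suc i) eq unique with nothing⊎just (chosen A s zero)
... | inj₁ none rewrite selectedArcs-nothing A s none =
  indeg-selectedArcs-1 (A ∘ suc) (s ∘ suc) i eq (suc-injective ∘ unique)
... | inj₂ (e , p) rewrite selectedArcs-just A s p =
  trans (indeg-≢ e (selectedArcs (A ∘ suc) (s ∘ suc)) λ { refl → 0≢1+n (unique p) })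
    (indeg-selectedArcs-1 (A ∘ suc) (s ∘ suc) i eq (suc-injective ∘ unique))

realise : ∀ {n k} (A : Fin k → Digraph n) (σ : Partial {k} {Arc n}) →
  (∀ {i e} → σ i ≡ just e → e ∈ˡ A i) → ∃[ s ] (∀ i → chosen A s i ≡ σ i)
realise A σ valid = (λ i → proj₁ (pick i)) , (λ i → proj₂ (pick i))
  where
  pick : ∀ i → ∃[ p ] Maybe.map (lookup (A i)) p ≡ σ i
  pick i with nothing⊎just (σ i)
  ... | inj₁ none    = nothing , sym none
  ... | inj₂ (e , p) = just (index (valid p)) , trans (cong just (sym (lookup-index (valid p)))) (sym p)

-- Multi-roots and the conclusion.

two-candidates : ∀ {n k} (A : Fin k → Digraph (suc n)) → AtMostTwoMultiRoots A →
  ∃₂ λ a b → ∀ {v} → v ≢ a → v ≢ b → ¬ MultiRoot A v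
two-candidates A atMostTwo = search
  where
  multiRoot? : ∀ v → Dec (MultiRoot A v)
  multiRoot? v = any? λ i → any? λ j → ¬? (i ≟ j) ×-dec (indeg (A i) v ≟ⁿ 0) ×-dec (indeg (A j) v ≟ⁿ 0)

  search : ∃₂ λ a b → ∀ {v} → v ≢ a → v ≢ b → ¬ MultiRoot A v
  search with any? multiRoot?
  -- `a` and `b` may coincide: without multi-roots any vertex serves for both, and a single
  -- multi-root is taken twice.
  ... | no none = zero , zero , λ _ _ mv → none (_ , mv)
  ... | yes (a , ma) with any? (λ b → ¬? (b ≟ a) ×-dec multiRoot? b)
  ...   | no none = a , a , λ v≢a _ mv → none (_ , v≢a , mv)
  ...   | yes (b , b≢a , mb) = a , b , λ {v} v≢a v≢b mv →
            [ b≢a ∘ sym , [ v≢a ∘ sym , v≢b ∘ sym ]′ ]′ (atMostTwo a b v ma mb mv)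

module _ {m} (A : Fin m → Digraph (suc m)) (arb : ∀ i → SpanningArborescence (A i)) where

  root : Fin m → Fin (suc m)
  root i = proj₁ (proj₂ (arb i))

  isRoot : ∀ i → IsRoot (A i) (root i)
  isRoot i = proj₁ (proj₂ (proj₂ (arb i)))

  open RainbowTrees (λ e i → e ∈ˡ A i) root (λ i S {z} → path-exit S (root-path (A i) (arb i) z))
  open Tree

  tree⇒selection : ∀ {r S} → (∀ v → v ∈ S) → Tree r S → ∃[ s ] SpanningArborescence (selectedArcs A s)
  tree⇒selection {r} full T with realise A (σ T) (valid T)
  ... | s , agrees = s ,
    paths⇒connected _ (λ v → path-map (λ (i , p) → ∈-selectedArcs A s i (trans (agrees i) p)) (path T (full v))) ,
    r , indeg-selectedArcs-0 A s (λ {i} p → rootless T (trans (sym (agrees i)) p)) ,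
    λ v v≢r → let i , _ , p = in-arc T (full v) v≢r in
      indeg-selectedArcs-1 A s i (trans (agrees i) p) (λ {j} q → unique T (trans (sym (agrees j)) q) p)

  rainbow-arborescence : AtMostTwoMultiRoots A → ∃[ s ] SpanningArborescence (selectedArcs A s)
  rainbow-arborescence atMostTwo with two-candidates A atMostTwo
  ... | a , b , not-multi =
    let S , full , r , T = spanning-tree a b root-injective in tree⇒selection full T
    where
    root-injective : ∀ {i j v} → v ≢ a → v ≢ b → root i ≡ v → root j ≡ v → i ≡ j
    -- Two different colours with root `v` would make `v` a multi-root other than `a` and `b`.
    root-injective {i} {j} v≢a v≢b refl eq = decidable-stable (i ≟ j) λ i≢j →
      not-multi v≢a v≢b (i , j , i≢j , isRoot i , subst (IsRoot (A j)) eq (isRoot j))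

theorem3p5 : (n : ℕ) → 2 ≤ n → (A : Fin (n ∸ 1) → Digraph n) →
    (∀ i → SpanningArborescence (A i)) → AtMostTwoMultiRoots A →
    ∃[ s ] SpanningArborescence (selectedArcs A s)
theorem3p5 (suc m) _ A arb atMostTwo = rainbow-arborescence A arb atMostTwo
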